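{- Let $A$ be a finite alphabet, let $K \geq 1$ be an integer, and let $x \in A^\omega$ be a right-infinite word that is linearly recurrent with constant $K$ and aperiodic. Then $x \in \mathcal{P}_{\mathrm{m}}$. More specifically, $x \in \mathcal{P}_{\mathrm{m}}(K+1, k)$ for $$k = 2 + \sum_{i=0}^{K^5-1} 2 K^i (K+1)^{2i}.$$
   Context: $A^\omega$ is the set of right-infinite words $x = x_0 x_1 x_2 \cdots$ over $A$; $A^+$ is the set of nonempty finite words over $A$; $x_{[n,\infty)} = x_n x_{n+1} \cdots$. $\mathrm{Fact}^+ x \subset A^+$ is the set of nonempty finite factors (contiguous subwords) of $x$. $|u|$ denotes the length of a finite word $u$. Periodicity: $x$ is periodic if $x = x_{[n,\infty)}$ for some $n \geq 1$, and aperiodic otherwise. Linear recurrence: for $u \in \mathrm{Fact}^+ x$, a return to $u$ in $x$ is a word $w \in A^+$ such that $wu \in \mathrm{Fact}^+ x$ and $u$ occurs exactly twice in $wu$. The set of returns to $u$ in $x$ is denoted $\mathcal{R}_x(u)$. The word $x$ is linearly recurrent with constant $K$ if for all $u \in \mathrm{Fact}^+ x$ and all $w \in \mathcal{R}_x(u)$ we have $|w| \leq K|u|$. Colorings and factorizations: a factor coloring of $x$ is a function $c : \mathrm{Fact}^+ x \to C$ with $C$ a finite set. A factorization of a finite or right-infinite word $y$ is a sequence $(U_i)_i$ of nonempty finite factors of $y$ (a finite sequence if $y$ is finite) whose concatenation in order is $y$; its length is the number of words in the sequence. It is monotone if $|U_i| \leq |U_j|$ for all $i \leq j$, and $c$-monochromatic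 if $c(U_i) = c(U_j)$ for all $i, j$. Classes: for $h, k \geq 1$, $\mathcal{P}_{\mathrm{m}}(h,k)$ is the class of infinite words $x \in A^\omega$ for which there exists a factor coloring $c : \mathrm{Fact}^+ x \to C$ with $|C| \leq k$ such that no prefix of $x$ has a monotone $c$-monochromatic factorization of length $h$. For $h = \infty$, $\mathcal{P}_{\mathrm{m}}(\infty,k)$ is the class of infinite words $x$ for which there is a factor coloring $c$ with $|C| \leq k$ such that $x$ itself has no monotone $c$-monochromatic factorization (into infinitely many words). Finally $\mathcal{P}_{\mathrm{m}} = \bigcup_{k \geq 1} \mathcal{P}_{\mathrm{m}}(\infty,k)$.
   Formalization: "Linearly recurrent with constant K" is taken to include that every factor of x occurs infinitely often; with the bound on returns alone the claim fails, e.g. for x = aaabaaa… with K = 2, whose prefix aaa = a·a·a is monochromatic for every coloring. -}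

module Defs where

open import Level using (0ℓ)
open import Data.Nat using (ℕ; _+_; _*_; _≤_; _≥_)
open import Data.Fin using (Fin)
import Data.Fin as Fin
open import Data.List using (List; []; _++_; length; concat; applyUpTo; tabulate)
open import Data.Product using (_×_; ∃; ∃₂; ∃-syntax)
open import Data.Refinement using (Refinement; value)
open import Data.Sum using (_⊎_)
open import Function using (_∘_; _⇔_)
open import Relation.Binary using (Rel)
open import Relation.Binary.PropositionalEquality using (_≡_; _≢_; _≗_)
open import Relation.Nullary using (¬_)
open import Relation.Unary using (Pred)

private
  variable
    A I : Set
    k : ℕ

_^ω : Set → Set
A ^ω = ℕ → A

_[_,∞⟩ : A ^ω → ℕ → A ^ω
(x [ n ,∞⟩) i = x (n + i)

prefix : A ^ω → ℕ → List A
prefix = applyUpTo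

Periodic : A ^ω → Set
Periodic x = ∃[ n ] n ≥ 1 × x ≗ (x [ n ,∞⟩)

Aperiodic : A ^ω → Set
Aperiodic x = ¬ Periodic x

OccursAt : A ^ω → List A → ℕ → Set
OccursAt x u i = prefix (x [ i ,∞⟩) (length u) ≡ u

_∈Fact⁺_ : List A → A ^ω → Set
u ∈Fact⁺ x = u ≢ [] × ∃ (OccursAt x u)

-- The membership proof is irrelevant, so that a function on Fact⁺ x depends
-- on the word alone and not on a chosen occurrence of it.
Fact⁺ : A ^ω → Set
Fact⁺ {A} x = Refinement (List A) (_∈Fact⁺ x)

OccursInAt : List A → List A → ℕ → Set
OccursInAt v u i = ∃₂ λ s t → v ≡ s ++ u ++ t × length s ≡ i

OccursExactlyTwiceIn : List A → List A → Set
OccursExactlyTwiceIn u v =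
  ∃₂ λ i j → i ≢ j × (∀ r → OccursInAt v u r ⇔ (r ≡ i ⊎ r ≡ j))

IsReturn : A ^ω → List A → List A → Set
IsReturn x u w = w ≢ [] × (w ++ u) ∈Fact⁺ x × OccursExactlyTwiceIn u (w ++ u)

Recurrent : A ^ω → Set
Recurrent x = ∀ u → u ∈Fact⁺ x → ∀ n → ∃[ m ] m ≥ n × OccursAt x u m

-- Linear recurrence presupposes recurrence.  The length bound alone says
-- nothing about factors that occur only once: the word aaabaaa⋯ satisfies it
-- with K = 2 without being periodic, although it begins with a cube.
record LinearlyRecurrent (K : ℕ) (x : A ^ω) : Set where
  field
    recurrent    : Recurrent x
    return-bound : ∀ u → u ∈Fact⁺ x → ∀ w → IsReturn x u w →
                   length w ≤ K * length u

-- Finite sets of colors are taken to be Fin k, with k the cardinality.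
Coloring : A ^ω → ℕ → Set
Coloring x k = Fact⁺ x → Fin k

-- The index set I is Fin h for finite and ℕ for infinite sequences.
Monotone : (x : A ^ω) → Rel I 0ℓ → (I → Fact⁺ x) → Set
Monotone x _≼_ U = ∀ i j → i ≼ j → length (value (U i)) ≤ length (value (U j))

Monochromatic : (x : A ^ω) → Coloring x k → (I → Fact⁺ x) → Set
Monochromatic x c U = ∀ i j → c (U i) ≡ c (U j)

-- The blocks are given as factors of x, so that colorings apply to them; the
-- equation makes them factors of the prefix.
FactorizesPrefix : (x : A ^ω) {h : ℕ} → (Fin h → Fact⁺ x) → ℕ → Set
FactorizesPrefix x U n = concat (tabulate (value ∘ U)) ≡ prefix x n

-- The blocks are nonempty, so the finite concatenations have unbounded length
-- and determine the infinite one.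
Factorizes : (x : A ^ω) → (ℕ → Fact⁺ x) → Set
Factorizes x U =
  ∀ n → ∃[ m ] concat (applyUpTo (value ∘ U) n) ≡ prefix x m

𝒫ₘ[_,_] : ℕ → ℕ → Pred (A ^ω) 0ℓ
𝒫ₘ[ h , k ] x = ∃[ l ] l ≤ k × ∃ λ (c : Coloring x l) →
  ∀ n → ¬ (∃ λ (U : Fin h → Fact⁺ x) →
    FactorizesPrefix x U n × Monotone x Fin._≤_ U × Monochromatic x c U)

𝒫ₘ[∞,_] : ℕ → Pred (A ^ω) 0ℓ
𝒫ₘ[∞, k ] x = ∃[ l ] l ≤ k × ∃ λ (c : Coloring x l) →
  ¬ (∃ λ (U : ℕ → Fact⁺ x) →
    Factorizes x U × Monotone x _≤_ U × Monochromatic x c U)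

𝒫ₘ : Pred (A ^ω) 0ℓ
𝒫ₘ x = ∃[ k ] k ≥ 1 × 𝒫ₘ[∞, k ] x

{-# OPTIONS --safe #-}

-- Write P_n for the prefix of length n.  An aperiodic linearly recurrent word
-- has no run of period p and length (K + 1) p.  Hence, if P_n P_n and P_n′ P_n′
-- are prefixes of x and n < n′, then K (n′ − n) ≥ n: otherwise P_n would occur
-- at n and n′, too close to each other.  So K³ successive such n increase the
-- length by a factor of more than K².
--
-- Non-prefixes get one colour, prefixes v with v v not a prefix another one, and
-- the remaining P_n are coloured by their rank among the square prefixes modulo
-- K³.  In a monotone monochromatic factorization of a prefix into K + 1 blocks,
-- every block is a prefix of x, and so the square of the first block P_n is a
-- prefix.  If the blocks before the j-th are all P_n, then the j-th one recurs at
-- j n ≤ K n, so its length is below K² n, and by its colour it equals n.  Thus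
-- x begins with the (K + 1)-st power of P_n, a contradiction.
module Submission where

open import Defs
open import Data.Nat using (ℕ; _+_; _*_; _^_; _≥_)
open import Data.Fin using (Fin)
open import Data.List using (map; sum; upTo)
open import Data.Product using (_×_)
open import Relation.Unary using (_∈_)

open import Data.Empty using (⊥; ⊥-elim-irr)
open import Data.Irrelevant using ([_])
open import Data.Nat using (zero; suc; _∸_; _≤_; _<_; z≤n; s≤s; NonZero; _%_; _/_; >-nonZero)
open import Data.Nat.DivMod using (_mod_; m≡m%n+[m/n]*n; m%n<n; m<n*o⇒m/o<n; /-monoˡ-≤)
open import Data.Nat.Properties
open import Data.Nat.Tactic.RingSolver using (solve-∀)
open import Data.Fin using (zero; suc; toℕ)
import Data.Fin as Fin
open import Data.Fin.Properties using (fromℕ<-injective) renaming (_≟_ to _≟ᶠ_; suc-injective to sucᶠ-injective)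
open import Data.List using (List; []; _∷_; _++_; length; concat; applyUpTo; tabulate)
open import Data.List.Properties
  using (∷-injective; ∷-injectiveˡ; ∷-injectiveʳ; length-++; length-applyUpTo; applyUpTo-∷ʳ;
         ≡-dec; ++-identityʳ)
open import Data.List.Relation.Binary.Permutation.Propositional
  using (_↭_; prep; ↭-refl; ↭-reflexive; ↭-sym; ↭-trans; swap)
open import Data.List.Relation.Binary.Permutation.Propositional.Properties
  using (↭-singleton-inv; drop-∷; ∷↭∷ʳ)
open import Data.Product using (∃-syntax; _,_; proj₁; proj₂)
open import Data.Refinement using (value)
open import Data.Sum using (_⊎_; inj₁; inj₂)
open import Function using (_∘_; mk⇔)
open import Relation.Binary using (DecidableEquality)
open import Relation.Binary.PropositionalEquality
  using (_≡_; _≢_; refl; sym; trans; cong; cong₂; subst; subst₂; module ≡-Reasoning)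
open import Relation.Nullary using (¬_; yes; no; contradiction)
open import Relation.Unary using (Decidable)

-- Arithmetic preliminaries.

least : ∀ {P : ℕ → Set} → Decidable P → ∀ n → P n →
        ∃[ m ] P m × (∀ {r} → r < m → ¬ P r)
least P? zero    Pn = zero , Pn , λ ()
least P? (suc n) Pn with P? zero
... | yes P0 = zero , P0 , λ ()
... | no ¬P0 with m , Pm , min ← least (P? ∘ suc) n Pn =
  suc m , Pm , λ { {zero} _ → ¬P0 ; {suc r} (s≤s r<m) → min r<m }

%-≡⇒≡⊎≥ : ∀ a t d .{{_ : NonZero d}} → a % d ≡ (a + t) % d → t ≡ 0 ⊎ d ≤ t
%-≡⇒≡⊎≥ a t d eq with m≤n⇒m<n∨m≡n (/-monoˡ-≤ d (m≤m+n a t))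
... | inj₂ q≡ = inj₁ (+-cancelˡ-≡ a t 0 (begin
  a + t                            ≡⟨ m≡m%n+[m/n]*n (a + t) d ⟩
  (a + t) % d + (a + t) / d * d    ≡⟨ cong₂ (λ r q → r + q * d) eq q≡ ⟨
  a % d + a / d * d                ≡⟨ m≡m%n+[m/n]*n a d ⟨
  a                                ≡⟨ +-identityʳ a ⟨
  a + 0                            ∎))
  where open ≡-Reasoning
... | inj₁ q< = inj₂ (+-cancelˡ-≤ a d t (begin
  a + d                            ≡⟨ cong (_+ d) (m≡m%n+[m/n]*n a d) ⟩
  a % d + a / d * d + d            ≡⟨ rearrange (a % d) (a / d) d ⟩
  a % d + suc (a / d) * d          ≤⟨ +-monoʳ-≤ (a % d) (*-monoˡ-≤ d q<) ⟩
  a % d + (a + t) / d * d          ≡⟨ cong (_+ (a + t) / d * d) eq ⟩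
  (a + t) % d + (a + t) / d * d    ≡⟨ m≡m%n+[m/n]*n (a + t) d ⟨
  a + t                            ∎))
  where
  open ≤-Reasoning
  rearrange : ∀ r q d → r + q * d + d ≡ r + suc q * d
  rearrange = solve-∀

length≤sum : ∀ (f g : ℕ → ℕ) n → (∀ i → 1 ≤ f (g i)) → n ≤ sum (map f (applyUpTo g n))
length≤sum f g zero    1≤f = z≤n
length≤sum f g (suc n) 1≤f = +-mono-≤ (1≤f 0) (length≤sum f (g ∘ suc) n (1≤f ∘ suc))

-- Windows of an infinite word and their letter content.

module _ {A : Set} where

  prefix-cong : ∀ {y z : A ^ω} n → (∀ {i} → i < n → y i ≡ z i) → prefix y n ≡ prefix z n
  prefix-cong zero    eq = refl
  prefix-cong (suc n) eq = cong₂ _∷_ (eq (s≤s z≤n)) (prefix-cong n (eq ∘ s≤s))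

  prefix-injective : ∀ {y z : A ^ω} n → prefix y n ≡ prefix z n → ∀ {i} → i < n → y i ≡ z i
  prefix-injective (suc n) eq {zero}  _         = ∷-injectiveˡ eq
  prefix-injective (suc n) eq {suc i} (s≤s i<n) = prefix-injective n (∷-injectiveʳ eq) i<n

  prefix-+ : ∀ (y : A ^ω) m n → prefix y (m + n) ≡ prefix y m ++ prefix (y [ m ,∞⟩) n
  prefix-+ y zero    n = refl
  prefix-+ y (suc m) n = cong (y 0 ∷_) (prefix-+ (y ∘ suc) m n)

  prefix-split : ∀ (y : A ^ω) v w n → v ++ w ≡ prefix y n →
                 v ≡ prefix y (length v) × w ≡ prefix (y [ length v ,∞⟩) (n ∸ length v)
  prefix-split y []      w n       eq = refl , eq
  prefix-split y (a ∷ v) w (suc n) eq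
    with refl , eq′ ← ∷-injective eq
    with v≡ , w≡ ← prefix-split (y ∘ suc) v w n eq′ = cong (y 0 ∷_) v≡ , w≡

  prefix-drop-+ : ∀ (y : A ^ω) m n l → prefix ((y [ m ,∞⟩) [ n ,∞⟩) l ≡ prefix (y [ m + n ,∞⟩) l
  prefix-drop-+ y m n l = prefix-cong l λ {i} _ → cong y (sym (+-assoc m n i))

  ∷-↭-cancelʳ : ∀ {a b : A} as → a ∷ as ↭ b ∷ as → a ≡ b
  ∷-↭-cancelʳ []       ρ = ∷-injectiveˡ (↭-singleton-inv ρ)
  ∷-↭-cancelʳ {a} {b} (c ∷ as) ρ = ∷-↭-cancelʳ as (drop-∷
    (↭-trans (swap c a ↭-refl) (↭-trans ρ (swap b c ↭-refl))))

  -- Both sides list the `p + 1` letters from position 0, split off at the first or at the last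
  -- letter. So a slide by one letter preserves the content of a window exactly when `y 0` and `y p`
  -- agree.
  slide-↭ : ∀ (y : A ^ω) p → y 0 ∷ prefix (y ∘ suc) p ↭ y p ∷ prefix y p
  slide-↭ y p = ↭-trans (↭-reflexive (sym (applyUpTo-∷ʳ y p))) (↭-sym (∷↭∷ʳ (y p) (prefix y p)))

  slide-≡⇒↭ : ∀ (y : A ^ω) p → y p ≡ y 0 → prefix (y ∘ suc) p ↭ prefix y p
  slide-≡⇒↭ y p eq = drop-∷ (subst (λ a → y 0 ∷ prefix (y ∘ suc) p ↭ a ∷ prefix y p) eq (slide-↭ y p))

  slide-↭⇒≡ : ∀ (y : A ^ω) p → prefix (y ∘ suc) p ↭ prefix y p → y 0 ≡ y p
  slide-↭⇒≡ y p ρ = ∷-↭-cancelʳ (prefix y p)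
    (↭-trans (prep (y 0) (↭-sym ρ)) (slide-↭ y p))

-- Long runs in linearly recurrent words.

module _ {A : Set} (_≟_ : DecidableEquality A) {K : ℕ} {x : A ^ω}
         (lr : LinearlyRecurrent K x) where

  open LinearlyRecurrent lr

  -- For the least positive shift, the word `w` read up to the second occurrence of `u` is a return
  -- to `u`: any further occurrence in `w ++ u` would give a smaller shift. Thus `return-bound`
  -- applies.
  next-occurrence : ∀ m p → 1 ≤ p →
    ∃[ d ] 1 ≤ d × d ≤ K * p × prefix (x [ m + d ,∞⟩) p ≡ prefix (x [ m ,∞⟩) p
  next-occurrence m p 1≤p = suc d , s≤s z≤n , bound , again
    where
    y = x [ m ,∞⟩
    u = prefix y p

    |u|≡p : length u ≡ p
    |u|≡p = length-applyUpTo y p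

    u∈x : u ∈Fact⁺ x
    u∈x = (λ u≡[] → n≮0 (subst (1 ≤_) (trans (sym |u|≡p) (cong length u≡[])) 1≤p))
        , m , cong (prefix y) |u|≡p

    -- The shift is `r + 1`, which excludes the occurrence at `m` itself.
    Again : ℕ → Set
    Again r = prefix (x [ m + suc r ,∞⟩) p ≡ u

    later : ∃[ r ] Again r
    later with m′ , m<m′ , occ ← recurrent u u∈x (suc m) =
      m′ ∸ suc m ,
      trans (cong (λ l → prefix (x [ l ,∞⟩) p) (trans (+-suc m _) (m+[n∸m]≡n m<m′)))
            (trans (cong (prefix (x [ m′ ,∞⟩)) (sym |u|≡p)) occ)

    first : ∃[ r ] Again r × (∀ {i} → i < r → ¬ Again i)
    first = least (λ r → ≡-dec _≟_ _ _) (proj₁ later) (proj₂ later)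

    d     = proj₁ first
    again = proj₁ (proj₂ first)
    w     = prefix y (suc d)

    |w|≡ : length w ≡ suc d
    |w|≡ = length-applyUpTo y (suc d)

    wu≡ : w ++ u ≡ prefix y (suc d + p)
    wu≡ = sym (trans (prefix-+ y (suc d) p)
      (cong (w ++_) (trans (prefix-drop-+ x m (suc d) p) again)))

    |wu|≡ : length (w ++ u) ≡ suc d + p
    |wu|≡ = trans (cong length wu≡) (length-applyUpTo y (suc d + p))

    positions : ∀ s t → w ++ u ≡ s ++ u ++ t → length s ≡ 0 ⊎ length s ≡ suc d
    positions s t eq = dichotomy (length s) |s|≤ occ
      where
      |s|≤ : length s ≤ suc d
      |s|≤ = +-cancelʳ-≤ p _ _ (begin
        length s + p                      ≡⟨ cong (length s +_) |u|≡p ⟨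
        length s + length u               ≤⟨ m≤m+n _ (length t) ⟩
        length s + length u + length t    ≡⟨ +-assoc (length s) _ _ ⟩
        length s + (length u + length t)  ≡⟨ cong (length s +_) (length-++ u) ⟨
        length s + length (u ++ t)        ≡⟨ length-++ s ⟨
        length (s ++ u ++ t)              ≡⟨ cong length eq ⟨
        length (w ++ u)                   ≡⟨ |wu|≡ ⟩
        suc d + p                         ∎)
        where open ≤-Reasoning
      occ : prefix (x [ m + length s ,∞⟩) p ≡ u
      occ = trans (sym (prefix-drop-+ x m (length s) p))
        (trans (cong (prefix (y [ length s ,∞⟩)) (sym |u|≡p))
          (sym (proj₁ (prefix-split (y [ length s ,∞⟩) u t _
            (proj₂ (prefix-split y s (u ++ t) (suc d + p) (trans (sym eq) wu≡)))))))
      dichotomy : ∀ r → r ≤ suc d → prefix (x [ m + r ,∞⟩) p ≡ u → r ≡ 0 ⊎ r ≡ suc d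
      dichotomy zero    _         _   = inj₁ refl
      dichotomy (suc r) (s≤s r≤d) occ with m≤n⇒m<n∨m≡n r≤d
      ... | inj₁ r<d  = contradiction occ (proj₂ (proj₂ first) r<d)
      ... | inj₂ refl = inj₂ refl

    twice : OccursExactlyTwiceIn u (w ++ u)
    twice = 0 , suc d , (λ ()) , λ r → mk⇔
      (λ { (s , t , eq , refl) → positions s t eq })
      (λ { (inj₁ refl) → [] , _ , u-first , refl
         ; (inj₂ refl) → w , [] , cong (w ++_) (sym (++-identityʳ u)) , |w|≡ })
      where
      u-first : w ++ u ≡ u ++ prefix (y [ p ,∞⟩) (suc d)
      u-first = trans wu≡ (trans (cong (prefix y) (+-comm (suc d) p)) (prefix-+ y p (suc d)))

    bound : suc d ≤ K * p
    bound = subst₂ (λ a b → a ≤ K * b) |w|≡ |u|≡p (return-bound u u∈x w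
      ((λ ()) , ((λ ()) , m , trans (cong (prefix y) |wu|≡) (sym wu≡)) , twice))

  -- Moving right from `b`, the distance `s` to an occurrence drops by one per step. At distance 0
  -- it is renewed by `next-occurrence`, whose bound keeps it below `K * p` after the step.
  occurrence-in-window : ∀ p → 1 ≤ p → 1 ≤ K → ∀ b {m} → b ≤ m →
    ∃[ s ] s < K * p × prefix (x [ m + s ,∞⟩) p ≡ prefix (x [ b ,∞⟩) p
  occurrence-in-window p 1≤p 1≤K b {m} b≤m =
    subst (λ m → ∃[ s ] s < K * p × prefix (x [ m + s ,∞⟩) p ≡ prefix (x [ b ,∞⟩) p)
          (m∸n+n≡m b≤m) (from (m ∸ b))
    where
    from : ∀ k → ∃[ s ] s < K * p × prefix (x [ k + b + s ,∞⟩) p ≡ prefix (x [ b ,∞⟩) p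
    from zero = 0 , *-mono-≤ 1≤K 1≤p , cong (λ l → prefix (x [ l ,∞⟩) p) (+-identityʳ b)
    from (suc k) with from k
    ... | suc s , s<Kp , occ =
      s , <-trans (n<1+n s) s<Kp , trans (cong (λ l → prefix (x [ l ,∞⟩) p) (sym (+-suc (k + b) s))) occ
    ... | zero , _ , occ with next-occurrence (k + b) p 1≤p
    ...   | suc d , _ , d<Kp , occ′ =
      d , d<Kp ,
      trans (cong (λ l → prefix (x [ l ,∞⟩) p) (sym (+-suc (k + b) d)))
        (trans occ′ (trans (cong (λ l → prefix (x [ l ,∞⟩) p) (sym (+-identityʳ (k + b)))) occ))

  -- All p-windows inside a run of period p are permutations of each other, and
  -- every p-window of x occurs inside the run; a slide of the window by one
  -- letter thus preserves its content, so that the entering letter is the leaving one.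
  power⇒periodic : 1 ≤ K → ∀ a p → 1 ≤ p →
    (∀ {i} → i < K * p → x (a + (p + i)) ≡ x (a + i)) → Periodic x
  power⇒periodic 1≤K a p 1≤p rep = p , 1≤p , λ b →
    trans (cong x (sym (+-identityʳ b)))
      (trans (slide-↭⇒≡ (x [ b ,∞⟩) p (↭-trans
        (↭-reflexive (prefix-cong p λ {i} _ → cong x (+-suc b i)))
        (↭-trans (window (suc b)) (↭-sym (window b)))))
      (cong x (+-comm b p)))
    where
    -- This length leaves room for a `p`-window at every offset up to `K * p`.
    run : List A
    run = prefix (x [ a ,∞⟩) (K * p + p)

    |run|≡ : length run ≡ K * p + p
    |run|≡ = length-applyUpTo _ (K * p + p)

    run∈x : run ∈Fact⁺ x
    run∈x = (λ eq → n≮0 (≤-trans 1≤p (≤-trans (m≤n+m p (K * p))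
              (≤-reflexive (trans (sym |run|≡) (cong length eq))))))
          , a , cong (prefix (x [ a ,∞⟩)) |run|≡

    inside : ∀ i → i ≤ K * p → prefix (x [ a + i ,∞⟩) p ↭ prefix (x [ a ,∞⟩) p
    inside zero    _     = ↭-reflexive (cong (λ l → prefix (x [ l ,∞⟩) p) (+-identityʳ a))
    inside (suc i) i<Kp  = ↭-trans
      (↭-reflexive (prefix-cong p λ {j} _ → cong x (reindex a i j)))
      (↭-trans
        (slide-≡⇒↭ (x [ a + i ,∞⟩) p (trans (cong x (exchange a i p))
          (trans (rep i<Kp) (cong x (sym (+-identityʳ (a + i)))))))
        (inside i (<⇒≤ i<Kp)))
      where
      reindex : ∀ a i j → a + suc i + j ≡ a + i + suc j
      reindex = solve-∀
      exchange : ∀ a i p → a + i + p ≡ a + (p + i)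
      exchange = solve-∀

    window : ∀ b → prefix (x [ b ,∞⟩) p ↭ prefix (x [ a ,∞⟩) p
    -- The run recurs at some `a′ ≥ b`, and the window at `b` occurs again less than `K * p` after
    -- `a′`, hence inside this copy of the run.
    window b with recurrent run run∈x b
    ... | a′ , b≤a′ , occ with occurrence-in-window p 1≤p 1≤K b b≤a′
    ... | s , s<Kp , eq = ↭-trans (↭-reflexive (trans (sym eq) (prefix-cong p copy)))
                                  (inside s (<⇒≤ s<Kp))
      where
      copy : ∀ {i} → i < p → x (a′ + s + i) ≡ x (a + s + i)
      copy {i} i<p = trans (cong x (+-assoc a′ s i)) (trans
        (prefix-injective (K * p + p) (trans (cong (prefix (x [ a′ ,∞⟩)) (sym |run|≡)) occ)
          (+-mono-< s<Kp i<p))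
        (cong x (sym (+-assoc a s i))))

-- The equations give period `p` to the `p + K * p` letters from `a` on, which thus form a
-- `(K + 1)`-st power.
PowerFree : ∀ {A : Set} → ℕ → A ^ω → Set
PowerFree K x = ∀ a p → 1 ≤ p → ¬ (∀ {i} → i < K * p → x (a + (p + i)) ≡ x (a + i))

SquarePrefix : ∀ {A : Set} → A ^ω → ℕ → Set
SquarePrefix x n = ∀ {i} → i < n → x (n + i) ≡ x i

-- Gaps between square prefixes.

module _ {A : Set} (_≟_ : DecidableEquality A) {K : ℕ} {x : A ^ω}
         (power-free : PowerFree K x) where

  squarePrefix? : Decidable (SquarePrefix x)
  squarePrefix? n = allUpTo? (λ i → x (n + i) ≟ x i) n

  -- This is `K (n′ − n) ≥ n` without subtraction. If `K * d < n` for the difference `d`, the two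
  -- occurrences of the prefix of length `n` overlap in a run of period `d` starting at `n`.
  squares-apart : ∀ {n n′} → SquarePrefix x n → SquarePrefix x n′ → n < n′ → n + K * n ≤ K * n′
  squares-apart {n} {n′} sq sq′ n<n′ with d , refl ← m≤n⇒∃[o]m+o≡n (<⇒≤ n<n′) = begin
    n + K * n      ≤⟨ +-monoˡ-≤ (K * n) (≮⇒≥ close) ⟩
    K * d + K * n  ≡⟨ +-comm (K * d) (K * n) ⟩
    K * n + K * d  ≡⟨ *-distribˡ-+ K n d ⟨
    K * (n + d)    ∎
    where
    open ≤-Reasoning
    1≤d : 1 ≤ d
    1≤d = +-cancelˡ-< n 0 d (subst (_< n + d) (sym (+-identityʳ n)) n<n′)
    close : ¬ (K * d < n)
    close Kd<n = power-free n d 1≤d λ {i} i<Kd →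
      trans (cong x (sym (+-assoc n d i)))
        (trans (sq′ (<-trans i<Kd (<-trans Kd<n n<n′))) (sym (sq (<-trans i<Kd Kd<n))))

  -- The gain `s` from `squares-apart` is counted only as `n`: linear growth in the number of
  -- squares suffices.
  squares-apart-suc : ∀ {n n′ s} t → SquarePrefix x s → SquarePrefix x n′ → n ≤ s → s < n′ →
    K * n + t * n ≤ K * s → K * n + suc t * n ≤ K * n′
  squares-apart-suc {n} {n′} {s} t sq sq′ n≤s s<n′ far = begin
    K * n + (n + t * n)  ≡⟨ rearrange (K * n) n (t * n) ⟩
    n + (K * n + t * n)  ≤⟨ +-mono-≤ n≤s far ⟩
    s + K * s            ≤⟨ squares-apart sq sq′ s<n′ ⟩
    K * n′               ∎
    where
    open ≤-Reasoning
    rearrange : ∀ a b c → a + (b + c) ≡ b + (a + c)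
    rearrange = solve-∀

  -- The rank among square prefixes. The length 0 counts vacuously, which shifts the rank of every
  -- positive length by one.
  squaresBelow : ℕ → ℕ
  squaresBelow zero = 0
  squaresBelow (suc n) with squarePrefix? n
  ... | yes _ = suc (squaresBelow n)
  ... | no  _ = squaresBelow n

  squaresBelow-suc : ∀ {n} → SquarePrefix x n → squaresBelow (suc n) ≡ suc (squaresBelow n)
  squaresBelow-suc {n} sq with squarePrefix? n
  ... | yes _  = refl
  ... | no ¬sq = contradiction (λ {i} → sq {i}) ¬sq

  -- By construction `s` is the last square length from `n` to `n + k`, and `t` counts those above
  -- `n`. Carrying `s` along allows `squares-apart-suc` to be applied to the next square.
  last-square : ∀ {n} → SquarePrefix x n → ∀ k →
    ∃[ s ] ∃[ t ] n ≤ s × s ≤ n + k × SquarePrefix x s ×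
      squaresBelow (suc (n + k)) ≡ squaresBelow n + suc t × K * n + t * n ≤ K * s
  last-square {n} sq zero rewrite +-identityʳ n =
    n , 0 , ≤-refl , ≤-refl , sq ,
    trans (squaresBelow-suc sq) (+-comm 1 (squaresBelow n)) , ≤-reflexive (+-identityʳ (K * n))
  last-square {n} sq (suc k) rewrite +-suc n k with last-square sq k | squarePrefix? (suc (n + k))
  ... | s , t , n≤s , s≤ , sqs , count , far | no  _   =
    s , t , n≤s , m≤n⇒m≤1+n s≤ , sqs , count , far
  ... | s , t , n≤s , s≤ , sqs , count , far | yes sq′ =
    suc (n + k) , suc t , m≤n⇒m≤1+n (m≤m+n n k) , ≤-refl , sq′ ,
    trans (cong suc count) (sym (+-suc _ (suc t))) ,
    squares-apart-suc t sqs sq′ n≤s (s≤s s≤) far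

  squares-spread : ∀ {n n′} → SquarePrefix x n → SquarePrefix x n′ → n < n′ →
    ∃[ t ] squaresBelow n′ ≡ squaresBelow n + suc t × K * n + suc t * n ≤ K * n′
  squares-spread {n} {n′} sq sq′ n<n′ with k , refl ← m≤n⇒∃[o]m+o≡n n<n′ with last-square sq k
  ... | s , t , n≤s , s≤ , sqs , count , far =
    t , count , squares-apart-suc t sqs sq′ n≤s (s≤s s≤) far

  -- The colouring.

  module _ (1≤K : 1 ≤ K) where

    instance
      K^3-nonZero : NonZero (K ^ 3)
      K^3-nonZero = m^n≢0 K 3 {{>-nonZero 1≤K}}

    -- If `n < n′`, the ranks differ by at least `K ^ 3`, whence `K n + K³ n ≤ K n′ ≤ K³ n`,
    -- impossible for positive `K` and `n`.
    squaresBelow-%-injective : ∀ {n n′} → SquarePrefix x n → SquarePrefix x n′ →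
      1 ≤ n → n ≤ n′ → n′ < K * (K * n) →
      squaresBelow n % K ^ 3 ≡ squaresBelow n′ % K ^ 3 → n ≡ n′
    squaresBelow-%-injective {n} {n′} sq sq′ 1≤n n≤n′ n′<K²n eq with m≤n⇒m<n∨m≡n n≤n′
    ... | inj₂ n≡n′ = n≡n′
    ... | inj₁ n<n′ with squares-spread sq sq′ n<n′
    ...   | t , count , far
      with %-≡⇒≡⊎≥ (squaresBelow n) (suc t) (K ^ 3) (trans eq (cong (_% K ^ 3) count))
    ...     | inj₂ K³≤t = contradiction (*-mono-≤ 1≤K 1≤n) (<⇒≱ (s≤s Kn≤0))
      where
      open ≤-Reasoning
      cube : ∀ K n → K * (K * (K * n)) ≡ K * (K * (K * 1)) * n
      cube = solve-∀
      Kn≤0 : K * n ≤ 0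
      Kn≤0 = +-cancelʳ-≤ (K ^ 3 * n) (K * n) 0 (begin
        K * n + K ^ 3 * n  ≤⟨ +-monoʳ-≤ (K * n) (*-monoˡ-≤ n K³≤t) ⟩
        K * n + suc t * n  ≤⟨ far ⟩
        K * n′             ≤⟨ *-monoʳ-≤ K (<⇒≤ n′<K²n) ⟩
        K * (K * (K * n))  ≡⟨ cube K n ⟩
        K ^ 3 * n          ∎)

    colour : List A → Fin (2 + K ^ 3)
    colour v with ≡-dec _≟_ (prefix x (length v)) v | squarePrefix? (length v)
    ... | no  _ | _     = zero
    ... | yes _ | no  _ = suc zero
    ... | yes _ | yes _ = suc (suc (squaresBelow (length v) mod K ^ 3))

    colour-prefix : ∀ v w → colour v ≡ colour w →
      prefix x (length v) ≡ v → prefix x (length w) ≡ w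
    colour-prefix v w eq v-prefix
      with ≡-dec _≟_ (prefix x (length v)) v | squarePrefix? (length v)
         | ≡-dec _≟_ (prefix x (length w)) w | squarePrefix? (length w)
    ... | no ¬p | _     | _            | _ = contradiction v-prefix ¬p
    ... | yes _ | _     | yes w-prefix | _ = w-prefix
    colour-prefix v w () _ | yes _ | no  _ | no _ | _
    colour-prefix v w () _ | yes _ | yes _ | no _ | _

    colour-square : ∀ v w → colour v ≡ colour w →
      prefix x (length v) ≡ v → SquarePrefix x (length v) →
      SquarePrefix x (length w) ×
      squaresBelow (length v) % K ^ 3 ≡ squaresBelow (length w) % K ^ 3
    colour-square v w eq v-prefix sq
      with ≡-dec _≟_ (prefix x (length v)) v | squarePrefix? (length v)
         | ≡-dec _≟_ (prefix x (length w)) w | squarePrefix? (length w)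
    ... | no ¬p | _      | _     | _       = contradiction v-prefix ¬p
    ... | yes _ | no ¬sq | _     | _       = contradiction (λ {i} → sq {i}) ¬sq
    ... | yes _ | yes _  | yes _ | yes sq′ =
      sq′ , fromℕ<-injective _ _
        (m%n<n (squaresBelow (length v)) (K ^ 3)) (m%n<n (squaresBelow (length w)) (K ^ 3))
        (sucᶠ-injective (sucᶠ-injective eq))
    colour-square v w () _ _ | yes _ | yes _ | yes _ | no _
    colour-square v w () _ _ | yes _ | yes _ | no  _ | _

    -- Blocks that share the colour of the first block.

    module _ (u : List A) (1≤n : 1 ≤ length u) (u-prefix : prefix x (length u) ≡ u) where

      private n = length u

      SimilarTo-u : ∀ {h} → (Fin h → List A) → Set
      SimilarTo-u V = ∀ i → colour u ≡ colour (V i) × n ≤ length (V i)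

      block-prefix : ∀ {h} (V : Fin (suc h) → List A) a m → SimilarTo-u V →
        concat (tabulate V) ≡ prefix (x [ a ,∞⟩) m →
        ∀ {i} → i < length (V zero) → x (a + i) ≡ x i
      block-prefix V a m similar eq = prefix-injective (length (V zero)) (trans
        (sym (proj₁ (prefix-split (x [ a ,∞⟩) (V zero) _ m eq)))
        (sym (colour-prefix u (V zero) (proj₁ (similar zero)) u-prefix)))

      -- `V` lists the blocks after `u`. The first of them is a prefix of `x` by its colour and at
      -- least as long as `u`, so `x` begins with `u ++ u`.
      square : ∀ {h} (V : Fin h → List A) m → 1 ≤ h → SimilarTo-u V →
        concat (tabulate V) ≡ prefix (x [ n ,∞⟩) m → SquarePrefix x n
      square {suc h} V m _ similar eq i<n =
        block-prefix V n m similar eq (≤-trans i<n (proj₂ (similar zero)))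

      -- As `l` starts at 0, this is the `(j + 1)`-st power of `u`.
      PowerPrefix : ℕ → Set
      PowerPrefix j = ∀ l {i} → l ≤ j → i < n → x (l * n + i) ≡ x i

      ¬powerPrefix : ¬ PowerPrefix K
      -- Positions `i` and `n + i` have the same offset `i % n` in consecutive copies of `u`.
      ¬powerPrefix pow = power-free 0 n 1≤n λ {i} i<Kn → begin
        x (n + i)                      ≡⟨ cong (λ k → x (n + k)) (quot i) ⟩
        x (n + (i / n * n + i % n))    ≡⟨ cong x (+-assoc n _ _) ⟨
        x (suc (i / n) * n + i % n)    ≡⟨ pow (suc (i / n)) (m<n*o⇒m/o<n i<Kn) (m%n<n i n) ⟩
        x (i % n)                      ≡⟨ pow (i / n) (<⇒≤ (m<n*o⇒m/o<n i<Kn)) (m%n<n i n) ⟨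
        x (i / n * n + i % n)          ≡⟨ cong x (quot i) ⟨
        x i                            ∎
        where
        open ≡-Reasoning
        instance
          n-nonZero : NonZero n
          n-nonZero = >-nonZero 1≤n
        quot : ∀ i → i ≡ i / n * n + i % n
        quot i = trans (m≡m%n+[m/n]*n i n) (+-comm (i % n) _)

      -- Induction on the number `h` of blocks left, after `suc j` blocks equal to `u`. With none
      -- left, `x` begins with the `(K + 1)`-st power of `u`.
      no-similar-blocks : SquarePrefix x n → ∀ h j (V : Fin h → List A) m →
        h + j ≡ K → PowerPrefix j → SimilarTo-u V →
        concat (tabulate V) ≡ prefix (x [ suc j * n ,∞⟩) m → ⊥
      no-similar-blocks sq zero    j V m refl pow similar eq = ¬powerPrefix pow
      no-similar-blocks sq (suc h) j V m h+j≡K pow similar eq =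
        no-similar-blocks sq h (suc j) (V ∘ suc) (m ∸ length v)
          (trans (+-suc h j) h+j≡K) pow′ (similar ∘ suc)
          (trans (proj₂ (prefix-split (x [ a ,∞⟩) v _ m eq))
            (trans (prefix-drop-+ x a (length v) (m ∸ length v))
              (cong (λ b → prefix (x [ b ,∞⟩) (m ∸ length v))
                (trans (cong (a +_) (sym n≡|v|)) (+-comm a n)))))
        where
        v = V zero
        a = suc j * n

        again : ∀ {i} → i < length v → x (a + i) ≡ x i
        again = block-prefix V a m similar eq

        |v|<Ka : length v < K * a
        -- Otherwise the recurrence of the beginning of `x` at `a` is a `(K + 1)`-st power of period
        -- `a`.
        |v|<Ka = ≰⇒> λ Ka≤|v| → power-free 0 a (≤-trans 1≤n (m≤m+n n (j * n)))
          λ i<Ka → again (<-≤-trans i<Ka Ka≤|v|)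

        |v|<K²n : length v < K * (K * n)
        -- A block is still left, so `suc j ≤ K` and `a ≤ K * n`.
        |v|<K²n = <-≤-trans |v|<Ka
          (*-monoʳ-≤ K (*-monoˡ-≤ n (subst (suc j ≤_) h+j≡K (s≤s (m≤n+m j h)))))

        n≡|v| : n ≡ length v
        n≡|v| with sq′ , eq% ← colour-square u v (proj₁ (similar zero)) u-prefix sq =
          squaresBelow-%-injective sq sq′ 1≤n (proj₂ (similar zero)) |v|<K²n eq%

        pow′ : PowerPrefix (suc j)
        pow′ l l≤ i<n with m≤n⇒m<n∨m≡n l≤
        ... | inj₁ (s≤s l≤j) = pow l l≤j i<n
        ... | inj₂ refl      = again (subst (_ <_) n≡|v| i<n)

    -- The equation on `h` is there because `K + 1` does not reduce to a successor.
    no-monochromatic-blocks : ∀ {h} → h ≡ suc K → (V : Fin h → List A) → ∀ m →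
      (∀ i → V i ≢ []) → (∀ i j → i Fin.≤ j → length (V i) ≤ length (V j)) →
      (∀ i j → colour (V i) ≡ colour (V j)) →
      ¬ (concat (tabulate V) ≡ prefix x m)
    no-monochromatic-blocks refl V m V≢[] mono same eq
      with u≡ , rest ← prefix-split x (V zero) _ m eq =
      no-similar-blocks u 1≤|u| (sym u≡)
        (square u 1≤|u| (sym u≡) (V ∘ suc) _ 1≤K similar rest)
        K 0 (V ∘ suc) _ (+-identityʳ K) (λ { zero _ _ → refl }) similar
        (trans rest (cong (λ b → prefix (x [ b ,∞⟩) (m ∸ length u)) (sym (+-identityʳ (length u)))))
      where
      u = V zero
      1≤|u| : 1 ≤ length u
      1≤|u| with V zero in V0≡
      ... | []    = contradiction V0≡ (V≢[] zero)
      ... | _ ∷ _ = s≤s z≤n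
      similar : ∀ i → colour u ≡ colour (V (suc i)) × length u ≤ length (V (suc i))
      similar i = same zero (suc i) , mono zero (suc i) z≤n

-- From prefixes to the infinite word, and the number of colours.

value≢[] : ∀ {A : Set} {x : A ^ω} (u : Fact⁺ x) → value u ≢ []
-- The membership proof is irrelevant but may still be used to derive an absurdity.
value≢[] (v Data.Refinement., [ pf ]) v≡[] = ⊥-elim-irr (proj₁ pf v≡[])

tabulate-toℕ : ∀ {A : Set} (f : ℕ → A) n → tabulate {n = n} (f ∘ toℕ) ≡ applyUpTo f n
tabulate-toℕ f zero    = refl
tabulate-toℕ f (suc n) = cong (f 0 ∷_) (tabulate-toℕ (f ∘ suc) n)

-- The first `h` blocks of an infinite factorization factorize a prefix, so the same colouring
-- serves.
𝒫ₘ[h]⇒𝒫ₘ[∞] : ∀ {A : Set} {x : A ^ω} h k → x ∈ 𝒫ₘ[ h , k ] → x ∈ 𝒫ₘ[∞, k ]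
𝒫ₘ[h]⇒𝒫ₘ[∞] h k (l , l≤k , c , none) = l , l≤k , c , λ (U , fact , mono , same) →
  none (proj₁ (fact h)) (U ∘ toℕ ,
    trans (cong concat (tabulate-toℕ (value ∘ U) h)) (proj₂ (fact h)) ,
    (λ i j i≤j → mono (toℕ i) (toℕ j) i≤j) , (λ i j → same (toℕ i) (toℕ j)))

theorem6 : ∀ (q K : ℕ) → K ≥ 1 → (x : Fin q ^ω) →
    LinearlyRecurrent K x → Aperiodic x →
    x ∈ 𝒫ₘ ×
    x ∈ 𝒫ₘ[ K + 1 , 2 + sum (map (λ i → 2 * K ^ i * (K + 1) ^ (2 * i)) (upTo (K ^ 5))) ]
theorem6 q K K≥1 x lr aperiodic =
  (_ , s≤s z≤n , 𝒫ₘ[h]⇒𝒫ₘ[∞] (K + 1) _ finite) , finite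
  where
  instance
    K-nonZero : NonZero K
    K-nonZero = >-nonZero K≥1
    K+1-nonZero : NonZero (K + 1)
    K+1-nonZero = >-nonZero (m≤n+m 1 K)

  power-free : PowerFree K x
  power-free a p 1≤p rep = aperiodic (power⇒periodic _≟ᶠ_ lr K≥1 a p 1≤p rep)

  budget : 2 + K ^ 3 ≤ 2 + sum (map (λ i → 2 * K ^ i * (K + 1) ^ (2 * i)) (upTo (K ^ 5)))
  -- The sum has `K ^ 5` terms, each at least 1, and `K ^ 3 ≤ K ^ 5`.
  budget = s≤s (s≤s (≤-trans (^-monoʳ-≤ K (m≤m+n 3 2)) (length≤sum _ _ (K ^ 5)
    λ i → *-mono-≤ (*-mono-≤ (s≤s {n = 1} z≤n) (m^n>0 K i)) (m^n>0 (K + 1) (2 * i)))))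

  finite : x ∈ 𝒫ₘ[ K + 1 , 2 + sum (map (λ i → 2 * K ^ i * (K + 1) ^ (2 * i)) (upTo (K ^ 5))) ]
  finite = 2 + K ^ 3 , budget , colour _≟ᶠ_ power-free K≥1 ∘ value , λ n (U , fact , mono , same) →
    no-monochromatic-blocks _≟ᶠ_ power-free K≥1 (+-comm K 1) (value ∘ U) n
      (value≢[] {x = x} ∘ U) mono same fact
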